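{- For every real $\varepsilon>0$, there is a constant $C(\varepsilon)$ such that, for every positive integer $n$, every bipartite graph $G$ on $n$ vertices with maximum degree $2$ admits an ordering $\mathcal{G}$ of $G$ that is contained (as an ordered subgraph) in every ordered graph with $N:=C(\varepsilon)n$ vertices and with at least $\varepsilon N^2$ edges.
   Context: An ordered graph is a pair $\mathcal{G}=(G,\prec)$ where $G$ is a (simple) graph and $\prec$ is a total ordering of its vertices; $\mathcal{G}$ is called an ordering of $G$. Two ordered graphs are isomorphic if there is a graph isomorphism between them preserving the vertex orderings. An ordered graph $\mathcal{G}$ is contained in an ordered graph $\mathcal{H}=(H,\prec)$ if $\mathcal{G}$ is isomorphic to some ordered graph $(G',\prec')$ with $G'$ a subgraph of $H$ and $\prec'$ the restriction of $\prec$ to $V(G')$. The convention is that floor and ceiling signs are omitted when not crucial (so $N=C(\varepsilon)n$ is understood as an integer). -}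

module Defs where

open import Level using (0ℓ)
open import Data.Bool.Base using (Bool; T)
open import Data.Bool.Properties using (T-irrelevant)
open import Data.Fin.Base using (Fin)
import Data.Fin.Properties as Fin
open import Data.Integer.Base using (+_)
open import Data.List.Base using (length; filter; map; allFin; cartesianProduct)
open import Data.List.Extrema.Nat using (max)
open import Data.Nat.Base using (ℕ)
open import Data.Product.Base using (Σ-syntax; ∃; _×_; _,_; proj₁; proj₂)
open import Data.Rational.Base as ℚ using (ℚ; 0ℚ; _/_)
open import Data.Sum.Base using (_⊎_)
open import Function.Base using (_∘_)
open import Function.Bundles using (_↔_; _⇔_; Inverse)
open import Relation.Binary.Core using (Rel)
open import Relation.Binary.Definitions
  using (Decidable; Symmetric; Irreflexive; Trichotomous; tri<; tri≈; tri>)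
open import Relation.Binary.Structures using (IsStrictTotalOrder)
open import Relation.Binary.PropositionalEquality
  using (_≡_; _≢_; refl; cong; isEquivalence; resp₂)
open import Relation.Nullary.Negation.Core using (¬_)
open import Relation.Nullary.Decidable.Core using (_×-dec_)
open import Relation.Unary using (Pred)

-- Two-sided Dedekind cuts: `Lower q` means q < x and `Upper q` means x < q.
record ℝ : Set₁ where
  field
    Lower Upper     : Pred ℚ 0ℓ
    lower-inhabited : ∃ Lower
    upper-inhabited : ∃ Upper
    lower-closed    : ∀ {p q} → p ℚ.< q → Lower q → Lower p
    lower-open      : ∀ {p} → Lower p → Σ[ q ∈ ℚ ] (p ℚ.< q × Lower q)
    upper-closed    : ∀ {p q} → p ℚ.< q → Upper p → Upper q
    upper-open      : ∀ {q} → Upper q → Σ[ p ∈ ℚ ] (p ℚ.< q × Upper p)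
    disjoint        : ∀ {q} → ¬ (Lower q × Upper q)
    located         : ∀ {p q} → p ℚ.< q → Lower p ⊎ Upper q

Positive : ℝ → Set
Positive x = ℝ.Lower x 0ℚ

fromℕ : ℕ → ℚ
fromℕ k = + k / 1

-- x * k ≤ m.  Since x is the supremum of its lower cut and k ≥ 0, this says
-- exactly that q * k ≤ m for every rational q < x.
infix 4 _*_≤ℝ_
_*_≤ℝ_ : ℝ → ℕ → ℕ → Set
x * k ≤ℝ m = ∀ q → ℝ.Lower x q → q ℚ.* fromℕ k ℚ.≤ fromℕ m

-- Adjacency is decidable so that the edges of a finite graph can be counted.
record Graph (V : Set) : Set₁ where
  field
    Adj         : Rel V 0ℓ
    adj?        : Decidable Adj
    symmetric   : Symmetric Adj
    irreflexive : Irreflexive _≡_ Adj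

open Graph public using (Adj; adj?)

Bipartite : ∀ {V} → Graph V → Set
Bipartite {V} G = Σ[ side ∈ (V → Bool) ] (∀ {u v} → Adj G u v → side u ≢ side v)

degree : ∀ {n} → Graph (Fin n) → Fin n → ℕ
degree {n} G v = length (filter (adj? G v) (allFin n))

maxDegree : ∀ {n} → Graph (Fin n) → ℕ
maxDegree {n} G = max 0 (map (degree G) (allFin n))

-- Each edge {u , v} is counted once, through its representative pair with
-- u < v in Fin n; this auxiliary order is unrelated to any ordering of the graph.
edgeCount : ∀ {n} → Graph (Fin n) → ℕ
edgeCount {n} G =
  length (filter (λ (u , v) → (u Fin.<? v) ×-dec adj? G u v)
                 (cartesianProduct (allFin n) (allFin n)))

record Ordering (V : Set) : Set₁ where
  field
    _≺_                : Rel V 0ℓ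
    isStrictTotalOrder : IsStrictTotalOrder _≡_ _≺_

OrderedGraph : Set → Set₁
OrderedGraph V = Graph V × Ordering V

Precedes : ∀ {V} → Ordering V → Rel V 0ℓ
Precedes = Ordering._≺_

record _≅_ {V W : Set} (𝓖 : OrderedGraph V) (𝓗 : OrderedGraph W) : Set where
  field
    bijection : V ↔ W

  to : V → W
  to = Inverse.to bijection

  field
    adj-iff   : ∀ u v → Adj (proj₁ 𝓖) u v ⇔ Adj (proj₁ 𝓗) (to u) (to v)
    order-iff : ∀ u v → Precedes (proj₂ 𝓖) u v ⇔ Precedes (proj₂ 𝓗) (to u) (to v)

-- The vertex set {v | S v ≡ true}; `T` is proof-irrelevant, so elements of
-- ⟦ S ⟧ are equal as soon as the underlying vertices are.
⟦_⟧ : ∀ {V : Set} → (V → Bool) → Set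
⟦_⟧ {V} S = Σ[ v ∈ V ] T (S v)

record Subgraph {V : Set} (H : Graph V) : Set₁ where
  field
    vertices : V → Bool
    graph    : Graph ⟦ vertices ⟧
    adj-sub  : ∀ {u v} → Adj graph u v → Adj H (proj₁ u) (proj₁ v)

restrict : ∀ {V} (S : V → Bool) → Ordering V → Ordering ⟦ S ⟧
restrict S O = record
  { _≺_ = λ u v → proj₁ u ≺ proj₁ v
  ; isStrictTotalOrder = record
    { isStrictPartialOrder = record
      { isEquivalence = isEquivalence
      ; irrefl        = λ { refl → O.irrefl refl }
      ; trans         = O.trans
      ; <-resp-≈      = resp₂ _
      }
    ; compare = cmp
    }
  }
  where
  open Ordering O using (_≺_)
  module O = IsStrictTotalOrder (Ordering.isStrictTotalOrder O)

  cmp : Trichotomous {A = ⟦ S ⟧} _≡_ (λ u v → proj₁ u ≺ proj₁ v)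
  cmp (u , p) (v , q) with O.compare u v
  ... | tri< a ¬b ¬c    = tri< a (¬b ∘ cong proj₁) ¬c
  ... | tri≈ ¬a refl ¬c = tri≈ ¬a (cong (u ,_) (T-irrelevant p q)) ¬c
  ... | tri> ¬a ¬b c    = tri> ¬a (¬b ∘ cong proj₁) c

infix 4 _ContainedIn_
_ContainedIn_ : ∀ {V W} → OrderedGraph V → OrderedGraph W → Set₁
𝓖 ContainedIn (H , O) =
  Σ[ G′ ∈ Subgraph H ] (𝓖 ≅ (Subgraph.graph G′ , restrict (Subgraph.vertices G′) O))

{-# OPTIONS --safe #-}

-- Layering each component of G by the distance from a chosen vertex, and the
-- components one after another, gives layers of at most two vertices, with all
-- edges between consecutive layers, since G is bipartite with maximum degree 2.
-- So G embeds in the path with every vertex doubled; G is ordered with the even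
-- layers first, then the odd ones, each in increasing order.
--
-- To find the doubled path in a dense ordered graph H, cut its vertices into
-- intervals and choose a dense pair of distinct ones, seen as a 0/1 matrix.
-- Group the rows into blocks of constant size. By pigeonhole there are p < p′
-- such that many (block, column) pairs have ones in both the p-th and the p′-th
-- row of the block. Do the same with the columns. Each one of the resulting
-- matrix stands for a 2 × 2 block of ones, so it suffices to find a long path
-- i₀ j₀ i₁ j₁ … in it, with both (iₗ) and (jₗ) increasing. It is found by
-- repeatedly deleting the last one of each row and of each column: an entry
-- that survives k rounds starts a path of length 2 k.

module Submission where

open import Defs

open import Data.Bool.Base as Bool using (Bool; true; false; T; not; _∧_; _∨_; if_then_else_; f<t)
import Data.Bool.Properties as Bool
open import Data.Fin.Base as Fin using (Fin; zero; suc; toℕ; fromℕ<; combine; cast; _↑ˡ_; _↑ʳ_)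
open import Data.Fin.Properties as Fin
  using (toℕ-injective; toℕ-combine; toℕ-cast; combine-monoˡ-<; cast-is-id; any?)
open import Data.Fin.Subset using (Subset; _∈_; _∉_; _-_; ∣_∣; ⊤; ⁅_⁆; Empty)
open import Data.Fin.Subset.Properties
  using (p─q─q≡p─q; x∈p⇒∣p-x∣<∣p∣; p─q⊆p; ∣p─q∣≤∣p∣; x∈p∧x≢y⇒x∈p-y; nonempty?; _∈?_; ∈⊤; ∣⊤∣≡n)
import Data.Integer.Base as ℤ
import Data.Integer.Properties as ℤ
open import Data.List.Base
  using (List; []; _∷_; _++_; length; filter; map; allFin; lookup; tabulate; cartesianProduct)
open import Data.List.Extrema.Nat using (xs≤max)
import Data.List.Membership.Propositional as List
open import Data.List.Membership.Propositional.Properties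
  using (∈-allFin; ∈-filter⁺; ∈-map⁺; ∈-lookup)
open import Data.List.Properties using (length-tabulate; filter-++; length-++)
open import Data.List.Relation.Binary.Permutation.Propositional using (_↭_; ↭-sym; ↭⇒↭ₛ)
open import Data.List.Relation.Binary.Permutation.Propositional.Properties using (map⁺; ↭-length)
import Data.List.Relation.Binary.Permutation.Setoid.Properties as Permutation
open import Data.List.Relation.Unary.All as All using ()
open import Data.List.Relation.Unary.AllPairs as AllPairs using (AllPairs; _∷_)
open import Data.List.Relation.Unary.Any using (here; there)
open import Data.List.Relation.Unary.Sorted.TotalOrder.Properties using (Sorted⇒AllPairs)
open import Data.List.Relation.Unary.Unique.Propositional using (Unique)
open import Data.List.Relation.Unary.Unique.Propositional.Properties using (allFin⁺)
open import Data.List.Sort using (sort; sort-↭; sort-↗)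
open import Data.Nat.Base as ℕ
  using (ℕ; zero; suc; _+_; _*_; _≤_; _<_; _<ᵇ_; z≤n; s≤s; s≤s⁻¹; ⌊_/2⌋; NonZero; >-nonZero)
import Data.Nat.ListAction as List
open import Data.Nat.ListAction.Properties using (sum-↭)
open import Data.Nat.Properties hiding (_≟_)
open import Data.Nat.Tactic.RingSolver using (solve-∀)
open import Data.Product.Base using (Σ-syntax; ∃; ∃-syntax; ∃₂; _×_; _,_; proj₁; proj₂)
open import Data.Product.Relation.Binary.Lex.Strict using (×-Lex; ×-isStrictTotalOrder)
open import Data.Product.Relation.Binary.Pointwise.NonDependent using (Pointwise)
open import Data.Rational.Base as ℚ using (ℚ; mkℚ; toℚᵘ; 0ℚ)
import Data.Rational.Properties as ℚ
open import Data.Rational.Unnormalised.Base as ℚᵘ using (mkℚᵘ; _≃_)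
import Data.Rational.Unnormalised.Properties as ℚᵘ
open import Data.Sum.Base using (_⊎_; inj₁; inj₂; [_,_]′)
open import Data.Unit.Base using (tt)
open import Function.Base using (_∘_; _on_; id)
open import Function.Bundles using (Equivalence; mk↔ₛ′; mk⇔)
open import Level using (0ℓ)
open import Relation.Binary.Bundles using (StrictTotalOrder)
open import Relation.Binary.Core using (Rel)
open import Relation.Binary.Definitions using (Tri; tri<; tri≈; tri>)
import Relation.Binary.Properties.StrictTotalOrder as StrictTotal
open import Relation.Binary.PropositionalEquality
open import Relation.Binary.Structures using (IsStrictTotalOrder)
open import Relation.Nullary
  using (Dec; yes; no; ¬_; contradiction; ⌊_⌋; toWitness; fromWitness; _×-dec_; _⊎-dec_)
open import Relation.Unary using (Decidable)

open import Algebra.Properties.CommutativeMonoid.Sum +-0-commutativeMonoid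
  using (sum; sum-cong-≗; ∑-distrib-+; ∑-comm)

-- Sums of indicators and 0/1 matrices

sum-mono-≤ : ∀ {n} {f g : Fin n → ℕ} → (∀ i → f i ≤ g i) → sum f ≤ sum g
sum-mono-≤ {zero}  f≤g = z≤n
sum-mono-≤ {suc n} f≤g = +-mono-≤ (f≤g zero) (sum-mono-≤ (f≤g ∘ suc))

sum-const : ∀ n k → sum {n} (λ _ → k) ≡ n * k
sum-const zero    k = refl
sum-const (suc n) k = cong (k +_) (sum-const n k)

sum-splitAt : ∀ m {n} (f : Fin (m + n) → ℕ) →
              sum f ≡ sum (f ∘ (_↑ˡ n)) + sum (f ∘ (m ↑ʳ_))
sum-splitAt zero    f = refl
sum-splitAt (suc m) f =
  trans (cong (f zero +_) (sum-splitAt m (f ∘ suc))) (sym (+-assoc (f zero) _ _))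

sum-combine : ∀ m {n} (f : Fin (m * n) → ℕ) →
              sum f ≡ sum (λ i → sum (λ j → f (combine {m} {n} i j)))
sum-combine zero        f = refl
sum-combine (suc m) {n} f =
  trans (sum-splitAt n f) (cong (sum (f ∘ (_↑ˡ m * n)) +_) (sum-combine m (f ∘ (n ↑ʳ_))))

pigeonhole : ∀ {n} (f : Fin n → ℕ) t → n * t < sum f → ∃[ i ] t < f i
pigeonhole {suc n} f t lt with t <? f zero
... | yes t<f₀ = zero , t<f₀
... | no  t≮f₀ with i , t<fᵢ ← pigeonhole (f ∘ suc) t
                     (+-cancelˡ-< t _ _ (<-≤-trans lt (+-monoˡ-≤ _ (≮⇒≥ t≮f₀)))) = suc i , t<fᵢ

m+[n+o]≡n+[m+o] : ∀ m n o → m + (n + o) ≡ n + (m + o)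
m+[n+o]≡n+[m+o] = solve-∀

-- Leaving out the term at `i` costs at most `b`, and the others still sum to more than `n * t`.
-- This keeps a choice of block off the diagonal.
pigeonhole-≢ : ∀ {n} (f : Fin n → ℕ) {b} t (i : Fin n) → f i ≤ b → b + n * t < sum f →
               ∃[ j ] i ≢ j × t < f j
pigeonhole-≢ {suc n} f {b} t zero f₀≤b lt
  with j , t<fⱼ ← pigeonhole (f ∘ suc) t
         (+-cancelˡ-< b _ _ (≤-<-trans (+-monoʳ-≤ b (m≤n+m _ t))
                                       (<-≤-trans lt (+-monoˡ-≤ _ f₀≤b))))
  = suc j , (λ ()) , t<fⱼ
pigeonhole-≢ {suc n} f {b} t (suc i) fᵢ≤b lt with t <? f zero
... | yes t<f₀ = zero , (λ ()) , t<f₀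
... | no  t≮f₀
  with j , i≢j , t<fⱼ ← pigeonhole-≢ (f ∘ suc) t i fᵢ≤b
         (+-cancelˡ-< t _ _ (<-≤-trans (subst (_< sum f) (m+[n+o]≡n+[m+o] b t (n * t)) lt)
                                       (+-monoˡ-≤ _ (≮⇒≥ t≮f₀))))
  = suc j , (λ { refl → i≢j refl }) , t<fⱼ

𝟙 : Bool → ℕ
𝟙 false = 0
𝟙 true  = 1

𝟙≤1 : ∀ b → 𝟙 b ≤ 1
𝟙≤1 false = z≤n
𝟙≤1 true  = s≤s z≤n

𝟙-mono : ∀ {b c} → (T b → T c) → 𝟙 b ≤ 𝟙 c
𝟙-mono {false}        h = z≤n
𝟙-mono {true} {true}  h = ≤-refl
𝟙-mono {true} {false} h = contradiction (h tt) (λ ())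

any : ∀ {n} → (Fin n → Bool) → Bool
any {zero}  x = false
any {suc n} x = x zero ∨ any (x ∘ suc)

any⇒∃ : ∀ {n} (x : Fin n → Bool) → T (any x) → ∃ (T ∘ x)
any⇒∃ {suc n} x h with x zero in eq
... | true  = zero , subst T (sym eq) tt
... | false with i , xᵢ ← any⇒∃ (x ∘ suc) h = suc i , xᵢ

¬any⇒sum≡0 : ∀ {n} (x : Fin n → Bool) → any x ≡ false → sum (𝟙 ∘ x) ≡ 0
¬any⇒sum≡0 {zero}  x h = refl
¬any⇒sum≡0 {suc n} x h with false ← x zero = ¬any⇒sum≡0 (x ∘ suc) h

any⇒1≤sum : ∀ {n} (x : Fin n → Bool) → any x ≡ true → 1 ≤ sum (𝟙 ∘ x)
any⇒1≤sum {suc n} x h with x zero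
... | true  = s≤s z≤n
... | false = any⇒1≤sum (x ∘ suc) h

-- Removes the last element of the set with indicator function x.
dropLast : ∀ {n} → (Fin n → Bool) → (Fin n → Bool)
dropLast x zero    = x zero ∧ any (x ∘ suc)
dropLast x (suc i) = dropLast (x ∘ suc) i

dropLast⇒next : ∀ {n} (x : Fin n → Bool) i → T (dropLast x i) → T (x i) × ∃[ j ] i Fin.< j × T (x j)
dropLast⇒next x zero h
  with x₀ , rest ← Equivalence.to Bool.T-∧ h
  with j , xⱼ ← any⇒∃ (x ∘ suc) rest = x₀ , suc j , s≤s z≤n , xⱼ
dropLast⇒next x (suc i) h
  with xᵢ , j , i<j , xⱼ ← dropLast⇒next (x ∘ suc) i h = xᵢ , suc j , s≤s i<j , xⱼ

sum-dropLast : ∀ {n} (x : Fin n → Bool) → sum (𝟙 ∘ x) ≤ 1 + sum (𝟙 ∘ dropLast x)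
sum-dropLast {zero}  x = z≤n
sum-dropLast {suc n} x with x zero | any (x ∘ suc) in eq
... | false | _     = sum-dropLast (x ∘ suc)
... | true  | true  = s≤s (sum-dropLast (x ∘ suc))
... | true  | false rewrite ¬any⇒sum≡0 (x ∘ suc) eq = s≤s z≤n

pair : ∀ {n} → (Fin n → Bool) → Fin n → Fin n → Bool
pair x p p′ = (toℕ p <ᵇ toℕ p′) ∧ (x p ∧ x p′)

pair⇒ : ∀ {n} (x : Fin n → Bool) p p′ → T (pair x p p′) → p Fin.< p′ × T (x p) × T (x p′)
pair⇒ x p p′ h with lt , rest ← Equivalence.to Bool.T-∧ h
  = <ᵇ⇒< (toℕ p) (toℕ p′) lt , Equivalence.to Bool.T-∧ rest

-- k ≤ 1 + k (k - 1) / 2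
sum≤1+pairs : ∀ {n} (x : Fin n → Bool) →
              sum (𝟙 ∘ x) ≤ 1 + sum (λ p → sum (λ p′ → 𝟙 (pair x p p′)))
sum≤1+pairs {zero}  x = z≤n
sum≤1+pairs {suc n} x with x zero
... | false = ≤-trans (sum≤1+pairs (x ∘ suc)) (s≤s (m≤n+m _ (sum {n} λ _ → 0)))
... | true with any (x ∘ suc) in eq
...   | false rewrite ¬any⇒sum≡0 (x ∘ suc) eq = s≤s z≤n
...   | true  = s≤s (≤-trans (sum≤1+pairs (x ∘ suc)) (+-monoˡ-≤ _ (any⇒1≤sum (x ∘ suc) eq)))

Matrix : ℕ → ℕ → Set
Matrix m n = Fin m → Fin n → Bool

infix 10 _ᵀ
_ᵀ : ∀ {m n} → Matrix m n → Matrix n m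
(A ᵀ) i j = A j i

count : ∀ {m n} → Matrix m n → ℕ
count A = sum (λ i → sum (λ j → 𝟙 (A i j)))

count-ᵀ : ∀ {m n} (A : Matrix m n) → count (A ᵀ) ≡ count A
count-ᵀ A = ∑-comm (λ i j → 𝟙 (A j i))

count≤ : ∀ {m n} (A : Matrix m n) → count A ≤ m * n
count≤ {m} {n} A = begin
  count A                     ≤⟨ sum-mono-≤ (λ i → sum-mono-≤ (λ j → 𝟙≤1 (A i j))) ⟩
  sum {m} (λ _ → sum {n} (λ _ → 1)) ≡⟨ cong (λ k → sum {m} (λ _ → k)) (trans (sum-const n 1) (*-identityʳ n)) ⟩
  sum {m} (λ _ → n)           ≡⟨ sum-const m n ⟩
  m * n ∎
  where open ≤-Reasoning

sum-1+ : ∀ {n} (f : Fin n → ℕ) → sum (λ i → 1 + f i) ≡ n + sum f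
sum-1+ {n} f = trans (∑-distrib-+ (λ _ → 1) f) (cong (_+ sum f) (trans (sum-const n 1) (*-identityʳ n)))

-- Zigzags by repeated deletion of last ones

dropLastInRows : ∀ {m n} → Matrix m n → Matrix m n
dropLastInRows A i = dropLast (A i)

count-dropLastInRows : ∀ {m n} (A : Matrix m n) → count A ≤ m + count (dropLastInRows A)
count-dropLastInRows {m} A = begin
  count A                                               ≤⟨ sum-mono-≤ (λ i → sum-dropLast (A i)) ⟩
  sum (λ i → 1 + sum (λ j → 𝟙 (dropLast (A i) j)))      ≡⟨ sum-1+ (λ i → sum (λ j → 𝟙 (dropLast (A i) j))) ⟩
  m + count (dropLastInRows A)                          ∎
  where open ≤-Reasoning

dropLastInColumns : ∀ {m n} → Matrix m n → Matrix m n
dropLastInColumns A = (dropLastInRows (A ᵀ)) ᵀ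

count-dropLastInColumns : ∀ {m n} (A : Matrix m n) → count A ≤ n + count (dropLastInColumns A)
count-dropLastInColumns {m} {n} A = begin
  count A                              ≡⟨ count-ᵀ A ⟨
  count (A ᵀ)                          ≤⟨ count-dropLastInRows (A ᵀ) ⟩
  n + count (dropLastInRows (A ᵀ))     ≡⟨ cong (n +_) (count-ᵀ (dropLastInRows (A ᵀ))) ⟨
  n + count (dropLastInColumns A)      ∎
  where open ≤-Reasoning

count>0⇒∃ : ∀ {m n} (A : Matrix m n) → 0 < count A → ∃₂ λ i j → T (A i j)
count>0⇒∃ {m} {n} A h
  with i , hᵢ ← pigeonhole (λ i → sum (λ j → 𝟙 (A i j))) 0 (subst (_< count A) (sym (*-zeroʳ m)) h)
  with j , hᵢⱼ ← pigeonhole (λ j → 𝟙 (A i j)) 0 (subst (_< sum (λ j → 𝟙 (A i j))) (sym (*-zeroʳ n)) hᵢ)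
  with true ← A i j in eq = i , j , subst T (sym eq) tt

-- The path x₀ y₀ x₁ y₁ … x_k y_k, with both (xᵢ) and (yᵢ) increasing, in the
-- bipartite graph with biadjacency matrix A.
record Zigzag {m n} (A : Matrix m n) (k : ℕ) (r : Fin m) (c : Fin n) : Set where
  field
    x       : ℕ → Fin m
    y       : ℕ → Fin n
    x-first : x 0 ≡ r
    y-first : y 0 ≡ c
    x-mono  : ∀ {i j} → i < j → j ≤ k → x i Fin.< x j
    y-mono  : ∀ {i j} → i < j → j ≤ k → y i Fin.< y j
    level   : ∀ {i} → i ≤ k → T (A (x i) (y i))
    up      : ∀ {i} → i < k → T (A (x (suc i)) (y i))

starts : ∀ {m n} → ℕ → Matrix m n → Matrix m n
starts zero    A = A
starts (suc k) A = dropLastInColumns (dropLastInRows (starts k A))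

-- One round loses at most one entry per row and one per column.
count-starts : ∀ {m n} k (A : Matrix m n) → count A ≤ k * (m + n) + count (starts k A)
count-starts             zero    A = ≤-refl
count-starts {m} {n} (suc k) A = begin
  count A                                                   ≤⟨ count-starts k A ⟩
  k * (m + n) + count (starts k A)                          ≤⟨ +-monoʳ-≤ (k * (m + n)) (count-dropLastInRows (starts k A)) ⟩
  k * (m + n) + (m + count (dropLastInRows (starts k A)))   ≤⟨ +-monoʳ-≤ (k * (m + n)) (+-monoʳ-≤ m (count-dropLastInColumns (dropLastInRows (starts k A)))) ⟩
  k * (m + n) + (m + (n + count (starts (suc k) A)))        ≡⟨ rearrange k m n (count (starts (suc k) A)) ⟩
  suc k * (m + n) + count (starts (suc k) A)                ∎
  where
  open ≤-Reasoning
  rearrange : ∀ k m n e → k * (m + n) + (m + (n + e)) ≡ (m + n + k * (m + n)) + e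
  rearrange = solve-∀

infixr 5 _◂_
_◂_ : ∀ {A : Set} → A → (ℕ → A) → (ℕ → A)
(a ◂ f) zero    = a
(a ◂ f) (suc i) = f i

◂-mono : ∀ {n k} (a : Fin n) (f : ℕ → Fin n) → a Fin.< f 0 →
         (∀ {i j} → i < j → j ≤ k → f i Fin.< f j) →
         ∀ {i j} → i < j → j ≤ suc k → (a ◂ f) i Fin.< (a ◂ f) j
◂-mono a f a<f₀ mono {zero}  {suc zero}    _         _         = a<f₀
◂-mono a f a<f₀ mono {zero}  {suc (suc j)} _         (s≤s j≤k) = <-trans a<f₀ (mono (s≤s z≤n) j≤k)
◂-mono a f a<f₀ mono {suc i} {suc j}       (s≤s i<j) (s≤s j≤k) = mono i<j j≤k

starts⊆ : ∀ {m n} k (A : Matrix m n) r c → T (starts k A r c) → T (A r c)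
starts⊆ zero    A r c h = h
starts⊆ (suc k) A r c h
  with h , _ ← dropLast⇒next (λ i → dropLastInRows (starts k A) i c) r h
  = starts⊆ k A r c (proj₁ (dropLast⇒next (starts k A r) c h))

-- The two deletions are undone in reverse order. If `(r , c)` outlives the column deletion, so does
-- the row deletion some `(r′ , c)` with `r′` later, and then `starts k A` has an entry `(r′ , c′)`
-- with `c′` later, where the rest of the path begins.
starts⇒Zigzag : ∀ {m n} k (A : Matrix m n) r c → T (starts k A r c) → Zigzag A k r c
starts⇒Zigzag zero    A r c h = record
  { x = λ _ → r ; y = λ _ → c ; x-first = refl ; y-first = refl
  ; x-mono = λ { () z≤n } ; y-mono = λ { () z≤n } ; level = λ _ → h ; up = λ () }
starts⇒Zigzag (suc k) A r c h
  with rc , r′ , r<r′ , r′c ← dropLast⇒next (λ i → dropLastInRows (starts k A) i c) r h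
  with rc , _ ← dropLast⇒next (starts k A r) c rc
  with r′c , c′ , c<c′ , r′c′ ← dropLast⇒next (starts k A r′) c r′c
  = record
  { x = r ◂ x ; y = c ◂ y ; x-first = refl ; y-first = refl
  ; x-mono = ◂-mono r x (subst (r Fin.<_) (sym x-first) r<r′) x-mono
  ; y-mono = ◂-mono c y (subst (c Fin.<_) (sym y-first) c<c′) y-mono
  ; level = λ { {zero} _ → starts⊆ k A r c rc ; {suc i} (s≤s i≤k) → level i≤k }
  ; up = λ { {zero}  _         → subst (λ i → T (A i c)) (sym x-first) (starts⊆ k A r′ c r′c)
           ; {suc i} (s≤s i<k) → up i<k }
  }
  where
  open Zigzag (starts⇒Zigzag k A r′ c′ r′c′)

zigzag : ∀ {m n} k (A : Matrix m n) → k * (m + n) < count A → ∃₂ (Zigzag A k)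
zigzag {m} {n} k A h
  with r , c , rc ← count>0⇒∃ (starts k A)
         (+-cancelˡ-< (k * (m + n)) _ _
           (<-≤-trans (subst (_< count A) (sym (+-identityʳ _)) h) (count-starts k A)))
  = r , c , starts⇒Zigzag k A r c rc

-- Doubled rows and dense off-diagonal blocks

-- The rows form `M` groups of `B` consecutive ones. The offsets `p` and `p′` are common to all
-- groups, so one pair of them serves a whole path.
doubleRows : ∀ {M B n} → Matrix (M * B) n → Fin B → Fin B → Matrix M n
doubleRows A p p′ i c = pair (λ p → A (combine i p) c) p p′

-- `sum≤1+pairs` is applied to each column of each group, and its summand 1 costs `M * n` in total.
-- The rest is exchange of sums.
count≤count-doubleRows : ∀ {M B n} (A : Matrix (M * B) n) →
  count A ≤ M * n + sum (λ p → sum (λ p′ → count (doubleRows {M} A p p′)))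
count≤count-doubleRows {M} {B} {n} A = begin
  count A
    ≡⟨ sum-combine M (λ r → sum (λ c → 𝟙 (A r c))) ⟩
  sum (λ i → sum (λ p → sum (λ c → 𝟙 (A (combine {M} i p) c))))
    ≡⟨ sum-cong-≗ (λ i → ∑-comm (λ p c → 𝟙 (A (combine {M} i p) c))) ⟩
  sum (λ i → sum (λ c → sum (λ p → 𝟙 (A (combine {M} i p) c))))
    ≤⟨ sum-mono-≤ (λ i → sum-mono-≤ (λ c → sum≤1+pairs (λ p → A (combine {M} i p) c))) ⟩
  sum (λ i → sum (λ c → 1 + pairs i c))
    ≡⟨ sum-cong-≗ (λ i → sum-1+ (pairs i)) ⟩
  sum (λ i → n + sum (pairs i))
    ≡⟨ ∑-distrib-+ (λ _ → n) (λ i → sum (pairs i)) ⟩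
  sum {M} (λ _ → n) + sum (λ i → sum (pairs i))
    ≡⟨ cong₂ _+_ (sum-const M n) (pull (λ i c p → sum (D i c p))) ⟩
  M * n + sum (λ p → sum (λ i → sum (λ c → sum (D i c p))))
    ≡⟨ cong (M * n +_) (sum-cong-≗ (λ p → pull (λ i c → D i c p))) ⟩
  M * n + sum (λ p → sum (λ p′ → count (doubleRows {M} A p p′)))
    ∎
  where
  open ≤-Reasoning
  D : Fin M → Fin n → Fin B → Fin B → ℕ
  D i c p p′ = 𝟙 (doubleRows {M} A p p′ i c)

  pairs : Fin M → Fin n → ℕ
  pairs i c = sum (λ p → sum (D i c p))

  pull : (f : Fin M → Fin n → Fin B → ℕ) →
         sum (λ i → sum (λ c → sum (f i c))) ≡ sum (λ p → sum (λ i → sum (λ c → f i c p)))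
  pull f = trans (sum-cong-≗ λ i → ∑-comm (f i)) (∑-comm (λ i p → sum (λ c → f i c p)))

count-doubleRows : ∀ {M B n} (A : Matrix (M * B) n) t → M * n + B * (B * t) < count A →
                   ∃₂ λ p p′ → t < count (doubleRows {M} A p p′)
count-doubleRows {M} {B} {n} A t h
  with p , hₚ ← pigeonhole (λ p → sum (λ p′ → count (doubleRows {M} A p p′))) (B * t)
                  (+-cancelˡ-< (M * n) _ _ (<-≤-trans h (count≤count-doubleRows {M} A)))
  = p , pigeonhole (λ p′ → count (doubleRows {M} A p p′)) t hₚ

block : ∀ {K m} → Matrix (K * m) (K * m) → Fin K → Fin K → Matrix m m
block A i j r c = A (combine i r) (combine j c)

count-blocks : ∀ {K m} (A : Matrix (K * m) (K * m)) →
               count A ≡ sum (λ i → sum (λ j → count (block {K} A i j)))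
count-blocks {K} {m} A = begin
  count A
    ≡⟨ sum-combine K (λ r → sum (λ c → 𝟙 (A r c))) ⟩
  sum (λ i → sum (λ r → sum (λ c → 𝟙 (A (combine {K} i r) c))))
    ≡⟨ sum-cong-≗ (λ i → sum-cong-≗ (λ r → sum-combine K (λ c → 𝟙 (A (combine {K} i r) c)))) ⟩
  sum (λ i → sum (λ r → sum (λ j → sum (λ c → 𝟙 (block {K} A i j r c)))))
    ≡⟨ sum-cong-≗ (λ i → ∑-comm (λ r j → sum (λ c → 𝟙 (block {K} A i j r c)))) ⟩
  sum (λ i → sum (λ j → count (block {K} A i j)))
    ∎
  where open ≡-Reasoning

-- The first pigeonhole picks a row of blocks, the second a block in it off the diagonal. By
-- symmetry that block may be taken above the diagonal, so that its row interval precedes its column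
-- interval.
offDiagonalBlock : ∀ {K m} (A : Matrix (K * m) (K * m)) → (∀ r c → T (A r c) → T (A c r)) →
                   ∀ t → K * (m * m + K * t) < count A →
                   ∃₂ λ i j → i Fin.< j × t < count (block {K} A i j)
offDiagonalBlock {K} {m} A A-sym t h
  with i , hᵢ ← pigeonhole (λ i → sum (λ j → count (block {K} A i j))) (m * m + K * t)
                  (subst (K * (m * m + K * t) <_) (count-blocks {K} A) h)
  with j , i≢j , hⱼ ← pigeonhole-≢ (λ j → count (block {K} A i j)) t i (count≤ (block {K} A i i)) hᵢ
  with <-cmp (toℕ i) (toℕ j)
... | tri< i<j _ _ = i , j , i<j , hⱼ
... | tri≈ _ i≡j _ = contradiction (toℕ-injective i≡j) i≢j
... | tri> _ _ j<i = j , i , j<i , <-≤-trans hⱼ (begin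
  count (block {K} A i j)      ≡⟨ count-ᵀ (block {K} A i j) ⟨
  count ((block {K} A i j) ᵀ)  ≤⟨ sum-mono-≤ (λ c → sum-mono-≤ (λ r → 𝟙-mono (A-sym (combine i r) (combine j c)))) ⟩
  count (block {K} A j i)      ∎)
  where open ≤-Reasoning

-- Layerings of bipartite graphs of maximum degree 2

-- The witnesses may coincide and need not satisfy `P`. They must exist even for empty `P`, whence
-- the default element in the next lemma.
AtMostTwo : {A : Set} → (A → Set) → Set
AtMostTwo P = ∃₂ λ p q → ∀ v → P v → v ≡ p ⊎ v ≡ q

length≤2⇒AtMostTwo : {A : Set} → A → (xs : List A) → length xs ≤ 2 → AtMostTwo (List._∈ xs)
length≤2⇒AtMostTwo a []           _ = a , a , λ _ ()
length≤2⇒AtMostTwo a (x ∷ [])     _ = x , x , λ { v (here v≡x) → inj₁ v≡x }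
length≤2⇒AtMostTwo a (x ∷ y ∷ []) _ =
  x , y , λ { v (here v≡x) → inj₁ v≡x ; v (there (here v≡y)) → inj₂ v≡y }
length≤2⇒AtMostTwo a (_ ∷ _ ∷ _ ∷ _) (s≤s (s≤s ()))

neighbours : ∀ {n} (G : Graph (Fin n)) → maxDegree G ≤ 2 → ∀ u → AtMostTwo (Adj G u)
neighbours {n} G Δ≤2 u
  with p , q , cover ← length≤2⇒AtMostTwo u (filter (adj? G u) (allFin n))
         (≤-trans (All.lookup (xs≤max 0 (map (degree G) (allFin n)))
                              (∈-map⁺ (degree G) (∈-allFin u))) Δ≤2)
  = p , q , λ v uv → cover v (∈-filter⁺ (adj? G u) (∈-allFin v) uv)

-- Otherwise removing `x` a second time would shrink `p - x`, although it changes nothing.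
x∉p-x : ∀ {n} (p : Subset n) x → x ∉ p - x
x∉p-x p x x∈p-x = <-irrefl (cong ∣_∣ (p─q─q≡p─q p ⁅ x ⁆)) (x∈p⇒∣p-x∣<∣p∣ x∈p-x)

module Layers {n} (G : Graph (Fin n)) (side : Fin n → Bool)
              (side-≢ : ∀ {u v} → Adj G u v → side u ≢ side v)
              (nbrs : ∀ u → AtMostTwo (Adj G u)) where

  -- Only the values on `U` are constrained. Layers have at most two vertices there, because
  -- `second` tells apart those sharing a layer.
  record Layering (U : Subset n) : Set where
    field
      layer       : Fin n → ℕ
      second      : Fin n → Bool
      layer<      : ∀ {u} → u ∈ U → layer u < ∣ U ∣
      injective   : ∀ {u v} → u ∈ U → v ∈ U → layer u ≡ layer v → second u ≡ second v → u ≡ v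
      consecutive : ∀ {u v} → u ∈ U → v ∈ U → Adj G u v →
                    layer v ≡ suc (layer u) ⊎ layer u ≡ suc (layer v)

  open Layering

  emptyLayering : ∀ {U} → Empty U → Layering U
  emptyLayering ∅ = record
    { layer = λ _ → 0 ; second = λ _ → false
    ; layer< = λ u∈U → contradiction (_ , u∈U) ∅
    ; injective = λ u∈U → contradiction (_ , u∈U) ∅
    ; consecutive = λ u∈U → contradiction (_ , u∈U) ∅ }

  -- The vertices `a` and `b`, possibly equal, form the first layer of `U`, and `Forward` is what
  -- the next one must contain. Being on the same side, `a` and `b` are not adjacent, and all of
  -- `Forward` is on the other side.
  module Step (U : Subset n) (a b : Fin n) (a∈U : a ∈ U) (same : side a ≡ side b) where

    rest : Subset n
    rest = U - a - b

    Forward : Fin n → Set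
    Forward v = v ∈ rest × (Adj G a v ⊎ Adj G b v)

    forward? : ∀ v → Dec (Forward v)
    forward? v = (v ∈? rest) ×-dec (adj? G a v ⊎-dec adj? G b v)

    a∉rest : a ∉ rest
    a∉rest = x∉p-x U a ∘ p─q⊆p (U - a) ⁅ b ⁆

    b∉rest : b ∉ rest
    b∉rest = x∉p-x (U - a) b

    ∣rest∣<∣U∣ : ∣ rest ∣ < ∣ U ∣
    ∣rest∣<∣U∣ = ≤-<-trans (∣p─q∣≤∣p∣ (U - a) ⁅ b ⁆) (x∈p⇒∣p-x∣<∣p∣ a∈U)

    -- The condition `u ≢ a` in `is-b` makes the cases exclusive: if `a ≡ b`, the common vertex is
    -- read as `is-a`.
    data View (u : Fin n) : Set where
      is-a    : u ≡ a → View u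
      is-b    : u ≢ a → u ≡ b → View u
      neither : u ≢ a → u ≢ b → View u

    view : ∀ u → View u
    view u with u Fin.≟ a | u Fin.≟ b
    ... | yes u≡a | _       = is-a u≡a
    ... | no  u≢a | yes u≡b = is-b u≢a u≡b
    ... | no  u≢a | no  u≢b = neither u≢a u≢b

    ∈rest : ∀ {u} → u ∈ U → u ≢ a → u ≢ b → u ∈ rest
    ∈rest u∈U u≢a u≢b = x∈p∧x≢y⇒x∈p-y (x∈p∧x≢y⇒x∈p-y u∈U u≢a) u≢b

    module _ (L : Layering rest) where
      private
        layer′ : ∀ {u} → View u → ℕ
        layer′ (is-a _)          = 0
        layer′ (is-b _ _)        = 0
        layer′ {u} (neither _ _) = suc (layer L u)

        second′ : ∀ {u} → View u → Bool
        second′ (is-a _)          = false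
        second′ (is-b _ _)        = true
        second′ {u} (neither _ _) = second L u

        layer<′ : ∀ {u} (p : View u) → u ∈ U → layer′ p < ∣ U ∣
        layer<′ (is-a _)          u∈U = ≤-<-trans z≤n ∣rest∣<∣U∣
        layer<′ (is-b _ _)        u∈U = ≤-<-trans z≤n ∣rest∣<∣U∣
        layer<′ (neither u≢a u≢b) u∈U = ≤-<-trans (layer< L (∈rest u∈U u≢a u≢b)) ∣rest∣<∣U∣

        injective′ : ∀ {u v} (p : View u) (q : View v) → u ∈ U → v ∈ U →
                     layer′ p ≡ layer′ q → second′ p ≡ second′ q → u ≡ v
        injective′ (is-a refl)   (is-a refl)   _ _ _ _ = refl
        injective′ (is-b _ refl) (is-b _ refl) _ _ _ _ = refl
        injective′ (neither u≢a u≢b) (neither v≢a v≢b) u∈U v∈U lu≡lv su≡sv =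
          injective L (∈rest u∈U u≢a u≢b) (∈rest v∈U v≢a v≢b) (suc-injective lu≡lv) su≡sv

        consecutive′ : (∀ {v} → Forward v → layer L v ≡ 0) →
                       ∀ {u v} (p : View u) (q : View v) → u ∈ U → v ∈ U → Adj G u v →
                       layer′ q ≡ suc (layer′ p) ⊎ layer′ p ≡ suc (layer′ q)
        consecutive′ first (is-a refl)   (is-a refl)   _ _ uv = contradiction refl (side-≢ uv)
        consecutive′ first (is-a refl)   (is-b _ refl) _ _ uv = contradiction same (side-≢ uv)
        consecutive′ first (is-b _ refl) (is-a refl)   _ _ uv = contradiction (sym same) (side-≢ uv)
        consecutive′ first (is-b _ refl) (is-b _ refl) _ _ uv = contradiction refl (side-≢ uv)
        consecutive′ first (is-a refl) (neither v≢a v≢b) _ v∈U uv =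
          inj₁ (cong suc (first (∈rest v∈U v≢a v≢b , inj₁ uv)))
        consecutive′ first (is-b _ refl) (neither v≢a v≢b) _ v∈U uv =
          inj₁ (cong suc (first (∈rest v∈U v≢a v≢b , inj₂ uv)))
        consecutive′ first (neither u≢a u≢b) (is-a refl) u∈U _ uv =
          inj₂ (cong suc (first (∈rest u∈U u≢a u≢b , inj₁ (Graph.symmetric G uv))))
        consecutive′ first (neither u≢a u≢b) (is-b _ refl) u∈U _ uv =
          inj₂ (cong suc (first (∈rest u∈U u≢a u≢b , inj₂ (Graph.symmetric G uv))))
        consecutive′ first (neither u≢a u≢b) (neither v≢a v≢b) u∈U v∈U uv
          with consecutive L (∈rest u∈U u≢a u≢b) (∈rest v∈U v≢a v≢b) uv
        ... | inj₁ eq = inj₁ (cong suc eq)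
        ... | inj₂ eq = inj₂ (cong suc eq)

        layer-a : (p : View a) → layer′ p ≡ 0
        layer-a (is-a _)        = refl
        layer-a (is-b _ _)      = refl
        layer-a (neither a≢a _) = contradiction refl a≢a

        layer-b : (p : View b) → layer′ p ≡ 0
        layer-b (is-a _)        = refl
        layer-b (is-b _ _)      = refl
        layer-b (neither _ b≢b) = contradiction refl b≢b

      -- An edge from the first layer into `rest` ends in `Forward`, on layer 0 of `L`, which the
      -- shift by one turns into layer 1.
      prepend : (∀ {v} → Forward v → layer L v ≡ 0) →
                Σ[ L′ ∈ Layering U ] layer L′ a ≡ 0 × layer L′ b ≡ 0
      prepend first = record
        { layer = layer′ ∘ view
        ; second = second′ ∘ view
        ; layer< = layer<′ (view _)
        ; injective = injective′ (view _) (view _)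
        ; consecutive = consecutive′ first (view _) (view _)
        } , layer-a (view a) , layer-b (view b)

    forward-side : ∀ {v} → Forward v → side v ≡ not (side a)
    forward-side (_ , inj₁ av) = Bool.¬-not (≢-sym (side-≢ av))
    forward-side (_ , inj₂ bv) = trans (Bool.¬-not (≢-sym (side-≢ bv))) (cong not (sym same))

    -- One of the at most two neighbours of `c` is `x`, outside `rest`. For a forward vertex `c`,
    -- `x` will be `a` or `b`.
    otherNeighbour : ∀ {c x} → x ∉ rest → Adj G c x →
                     ∃[ c⁺ ] (∀ {v} → v ∈ rest → Adj G c v → v ≡ c⁺)
    otherNeighbour {c} {x} x∉rest cx with p , q , cover ← nbrs c with cover x cx
    ... | inj₁ refl = q , λ v∈rest cv →
            [ (λ { refl → contradiction v∈rest x∉rest }) , (λ v≡q → v≡q) ]′ (cover _ cv)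
    ... | inj₂ refl = p , λ v∈rest cv →
            [ (λ v≡p → v≡p) , (λ { refl → contradiction v∈rest x∉rest }) ]′ (cover _ cv)

    onward : ∀ {c} → Forward c → ∃[ c⁺ ] (∀ {v} → v ∈ rest → Adj G c v → v ≡ c⁺)
    onward (_ , inj₁ ac) = otherNeighbour a∉rest (Graph.symmetric G ac)
    onward (_ , inj₂ bc) = otherNeighbour b∉rest (Graph.symmetric G bc)

    -- `covers` makes `prepend` applicable once `a′` and `b′` are on layer 0; `forward≤2` is the
    -- invariant for the recursive call.
    record Next : Set where
      field
        a′ b′   : Fin n
        a′∈rest : a′ ∈ rest
        b′∈rest : b′ ∈ rest
        same′   : side a′ ≡ side b′
        covers  : ∀ {v} → Forward v → v ≡ a′ ⊎ v ≡ b′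
        forward≤2 : AtMostTwo (λ v → v ∈ rest - a′ - b′ × (Adj G a′ v ⊎ Adj G b′ v))

    fromForward : ∀ {c d} → Forward c → Forward d → (∀ {v} → Forward v → v ≡ c ⊎ v ≡ d) → Next
    fromForward {c} {d} fc fd covers
      with c⁺ , hc ← onward fc
      with d⁺ , hd ← onward fd
      = record
      { a′ = c ; b′ = d ; a′∈rest = proj₁ fc ; b′∈rest = proj₁ fd
      ; same′ = trans (forward-side fc) (sym (forward-side fd))
      ; covers = covers
      ; forward≤2 = c⁺ , d⁺ , λ
        { v (v∈ , inj₁ cv) → inj₁ (hc (p─q⊆p rest ⁅ c ⁆ (p─q⊆p (rest - c) ⁅ d ⁆ v∈)) cv)
        ; v (v∈ , inj₂ dv) → inj₂ (hd (p─q⊆p rest ⁅ c ⁆ (p─q⊆p (rest - c) ⁅ d ⁆ v∈)) dv) } }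

    next : AtMostTwo Forward → Empty rest ⊎ Next
    -- The candidates need not lie in `Forward`, so this is decided; a single forward vertex is
    -- taken as both `a′` and `b′`.
    next (c , d , cover) with forward? c | forward? d
    ... | yes fc | yes fd = inj₂ (fromForward fc fd (cover _))
    ... | yes fc | no ¬fd = inj₂ (fromForward fc fc λ fv → only-c (cover _ fv) fv)
      where
      only-c : ∀ {v} → v ≡ c ⊎ v ≡ d → Forward v → v ≡ c ⊎ v ≡ c
      only-c (inj₁ v≡c)  fv = inj₁ v≡c
      only-c (inj₂ refl) fv = contradiction fv ¬fd
    ... | no ¬fc | yes fd = inj₂ (fromForward fd fd λ fv → only-d (cover _ fv) fv)
      where
      only-d : ∀ {v} → v ≡ c ⊎ v ≡ d → Forward v → v ≡ d ⊎ v ≡ d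
      only-d (inj₁ refl) fv = contradiction fv ¬fc
      only-d (inj₂ v≡d)  fv = inj₁ v≡d
    ... | no ¬fc | no ¬fd with nonempty? rest
    ...   | no  ∅       = inj₁ ∅
    -- No edge leads on, so a new component is started at any remaining vertex, and `covers` holds
    -- vacuously.
    ...   | yes (v , v∈rest) = inj₂ record
      { a′ = v ; b′ = v ; a′∈rest = v∈rest ; b′∈rest = v∈rest ; same′ = refl
      ; covers = λ fw → contradiction fw (none (cover _ fw))
      ; forward≤2 = proj₁ (nbrs v) , proj₁ (proj₂ (nbrs v)) , λ
        { w (_ , inj₁ vw) → proj₂ (proj₂ (nbrs v)) w vw
        ; w (_ , inj₂ vw) → proj₂ (proj₂ (nbrs v)) w vw } }
      where
      none : ∀ {w : Fin n} → w ≡ c ⊎ w ≡ d → ¬ Forward w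
      none (inj₁ refl) = ¬fc
      none (inj₂ refl) = ¬fd

  -- The bound `k` makes the recursion structural. The layers of `a` and `b` are returned because
  -- `prepend` needs them one step earlier.
  layering : ∀ k U a b (a∈U : a ∈ U) (same : side a ≡ side b) →
             AtMostTwo (Step.Forward U a b a∈U same) → ∣ U ∣ ≤ k →
             Σ[ L ∈ Layering U ] layer L a ≡ 0 × layer L b ≡ 0
  layering zero    U a b a∈U same ≤2 ∣U∣≤0 = contradiction ∣U∣≤0 (<⇒≱ (≤-<-trans z≤n (x∈p⇒∣p-x∣<∣p∣ a∈U)))
  layering (suc k) U a b a∈U same ≤2 ∣U∣≤k with Step.next U a b a∈U same ≤2
  ... | inj₁ ∅ = prepend (emptyLayering ∅) (λ fv → contradiction (_ , proj₁ fv) ∅)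
    where open Step U a b a∈U same
  ... | inj₂ N
    with L , la , lb ← layering k _ (Step.Next.a′ N) (Step.Next.b′ N) (Step.Next.a′∈rest N) (Step.Next.same′ N)
                         (Step.Next.forward≤2 N)
                         (s≤s⁻¹ (<-≤-trans (Step.∣rest∣<∣U∣ U a b a∈U same) ∣U∣≤k))
    = prepend L λ fv → first (Next.covers N fv)
    where
    open Step U a b a∈U same
    first : ∀ {v} → v ≡ Next.a′ N ⊎ v ≡ Next.b′ N → layer L v ≡ 0
    first (inj₁ refl) = la
    first (inj₂ refl) = lb

  layering-⊤ : 0 < n → Layering ⊤
  -- Vertex 0 is both `a` and `b`, so `Forward` lies among its at most two neighbours.
  layering-⊤ 0<n with p , q , cover ← nbrs (fromℕ< 0<n) =
    proj₁ (layering n ⊤ (fromℕ< 0<n) (fromℕ< 0<n) ∈⊤ refl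
      (p , q , λ { v (_ , inj₁ uv) → cover v uv ; v (_ , inj₂ uv) → cover v uv })
      (≤-reflexive (∣⊤∣≡n n)))

-- Embeddings of ordered graphs

-- `_≈_` is kept general because the lexicographic order on keys is total up to componentwise
-- equality.
pullback : {A B : Set} {_≈_ _≺_ : Rel B 0ℓ} → IsStrictTotalOrder _≈_ _≺_ → (f : A → B) →
           (∀ {x y} → f x ≈ f y → x ≡ y) → Ordering A
pullback {_≺_ = _≺_} O f f-inj = record
  { _≺_ = _≺_ on f
  ; isStrictTotalOrder = record
    { isStrictPartialOrder = record
      { isEquivalence = isEquivalence
      ; irrefl        = λ { refl → O.irrefl O.Eq.refl }
      ; trans         = O.trans
      ; <-resp-≈      = resp₂ _
      }
    ; compare = λ x y → case x y (O.compare (f x) (f y))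
    }
  }
  where
  module O = IsStrictTotalOrder O
  case : ∀ x y → Tri _ _ _ → Tri (f x ≺ f y) (x ≡ y) (f y ≺ f x)
  case x y (tri< a ¬b ¬c) = tri< a (λ { refl → ¬b O.Eq.refl }) ¬c
  case x y (tri≈ ¬a b ¬c) = tri≈ ¬a (f-inj b) ¬c
  case x y (tri> ¬a ¬b c) = tri> ¬a (λ { refl → ¬b O.Eq.refl }) c

module Embed {m n} (G : Graph (Fin m)) (O : Ordering (Fin m)) (H : Graph (Fin n)) (P : Ordering (Fin n))
             (f : Fin m → Fin n)
             (f-mono : ∀ {u v} → Precedes O u v → Precedes P (f u) (f v))
             (f-adj  : ∀ {u v} → Adj G u v → Adj H (f u) (f v)) where
  private
    module O = IsStrictTotalOrder (Ordering.isStrictTotalOrder O)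
    module P = IsStrictTotalOrder (Ordering.isStrictTotalOrder P)

    f-reflects : ∀ {u v} → Precedes P (f u) (f v) → Precedes O u v
    f-reflects {u} {v} fu≺fv with O.compare u v
    ... | tri< u≺v _ _  = u≺v
    ... | tri≈ _ refl _ = contradiction fu≺fv (P.irrefl refl)
    ... | tri> _ _ v≺u  = contradiction fu≺fv (P.asym (f-mono v≺u))

    f-injective : ∀ {u v} → f u ≡ f v → u ≡ v
    f-injective {u} {v} fu≡fv with O.compare u v
    ... | tri< u≺v _ _ = contradiction (f-mono u≺v) (P.irrefl fu≡fv)
    ... | tri≈ _ u≡v _ = u≡v
    ... | tri> _ _ v≺u = contradiction (f-mono v≺u) (P.irrefl (sym fu≡fv))

    image? : ∀ w → Dec (∃[ u ] f u ≡ w)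
    image? w = any? (λ u → f u Fin.≟ w)

    image : Fin n → Bool
    image w = ⌊ image? w ⌋

    from : ⟦ image ⟧ → Fin m
    from (w , t) = proj₁ (toWitness {a? = image? w} t)

    f-from : ∀ x → f (from x) ≡ proj₁ x
    f-from (w , t) = proj₂ (toWitness {a? = image? w} t)

    to : Fin m → ⟦ image ⟧
    to u = f u , fromWitness (u , refl)

    from-to : ∀ u → from (to u) ≡ u
    from-to u = f-injective (f-from (to u))

    to-from : ∀ x → to (from x) ≡ x
    to-from x = Σ-≡ (f-from x)
      where
      Σ-≡ : ∀ {x y : ⟦ image ⟧} → proj₁ x ≡ proj₁ y → x ≡ y
      Σ-≡ {w , s} {.w , t} refl = cong (w ,_) (Bool.T-irrelevant s t)

  -- Since `O` is total, a monotone `f` is injective and reflects the order. The subgraph has only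
  -- the edges carried over from `G`, as `H` may have more.
  contained : (G , O) ContainedIn (H , P)
  contained = record
    { vertices = image
    ; graph = record
      { Adj         = Adj G on from
      ; adj?        = λ x y → adj? G (from x) (from y)
      ; symmetric   = Graph.symmetric G
      ; irreflexive = λ { refl → Graph.irreflexive G refl }
      }
    ; adj-sub = λ {x} {y} xy → subst₂ (Adj H) (f-from x) (f-from y) (f-adj xy)
    } , record
    { bijection = mk↔ₛ′ to from to-from from-to
    ; adj-iff   = λ u v → mk⇔ (subst₂ (Adj G) (sym (from-to u)) (sym (from-to v)))
                              (subst₂ (Adj G) (from-to u) (from-to v))
    ; order-iff = λ u v → mk⇔ f-mono f-reflects
    }

-- The ordering of a layered graph by parity

parity : ℕ → Bool
parity zero    = false
parity (suc l) = not (parity l)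

parity-half-injective : ∀ k l → parity k ≡ parity l → ⌊ k /2⌋ ≡ ⌊ l /2⌋ → k ≡ l
parity-half-injective zero          zero          _ _ = refl
parity-half-injective (suc zero)    (suc zero)    _ _ = refl
parity-half-injective zero          (suc (suc l)) _ ()
parity-half-injective zero          (suc zero)    () _
parity-half-injective (suc zero)    zero          () _
parity-half-injective (suc zero)    (suc (suc l)) _ ()
parity-half-injective (suc (suc k)) zero          _ ()
parity-half-injective (suc (suc k)) (suc zero)    _ ()
parity-half-injective (suc (suc k)) (suc (suc l)) p h =
  cong (ℕ.suc ∘ ℕ.suc) (parity-half-injective k l
    (trans (sym (Bool.not-involutive (parity k))) (trans p (Bool.not-involutive (parity l))))
    (suc-injective h))

-- An edge from an even layer to the next one becomes a `level` edge of the ladder; one from an odd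
-- layer becomes an `up` edge and raises the index.
half-suc : ∀ l → (parity l ≡ false × parity (suc l) ≡ true × ⌊ suc l /2⌋ ≡ ⌊ l /2⌋)
               ⊎ (parity l ≡ true × parity (suc l) ≡ false × ⌊ suc l /2⌋ ≡ suc ⌊ l /2⌋)
half-suc zero          = inj₁ (refl , refl , refl)
half-suc (suc zero)    = inj₂ (refl , refl , refl)
half-suc (suc (suc l)) rewrite Bool.not-involutive (parity l) with half-suc l
... | inj₁ (p , q , h) = inj₁ (p , q , cong ℕ.suc h)
... | inj₂ (p , q , h) = inj₂ (p , q , cong ℕ.suc h)

-- The path 0, 1, 2, … with each vertex doubled: its vertex 2 j, respectively
-- 2 j + 1, corresponds to the pair at false j, respectively true j.
record Ladder {n} (H : Graph (Fin n)) (P : Ordering (Fin n)) (k : ℕ) : Set where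
  field
    at    : Bool → ℕ → Bool → Fin n
    sides : ∀ {i j} s t → i ≤ k → j ≤ k → Precedes P (at false i s) (at true j t)
    mono  : ∀ b {i j} s t → i < j → j ≤ k → Precedes P (at b i s) (at b j t)
    pairs : ∀ b {j} → j ≤ k → Precedes P (at b j false) (at b j true)
    level : ∀ {j} s t → j ≤ k → Adj H (at false j s) (at true j t)
    up    : ∀ {j} s t → j < k → Adj H (at false (suc j) s) (at true j t)

-- Parity of the layer, half of it, and the place in the layer. As `false` is below `true`, the even
-- layers come first.
Key : Set
Key = Bool × ℕ × Bool

_<ₗ_ : Rel Key 0ℓ
_<ₗ_ = ×-Lex _≡_ Bool._<_ (×-Lex _≡_ _<_ Bool._<_)

<ₗ-isStrictTotalOrder : IsStrictTotalOrder (Pointwise _≡_ (Pointwise _≡_ _≡_)) _<ₗ_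
<ₗ-isStrictTotalOrder = ×-isStrictTotalOrder Bool.<-isStrictTotalOrder
  (×-isStrictTotalOrder <-isStrictTotalOrder Bool.<-isStrictTotalOrder)

module LadderOrder {n} (G : Graph (Fin n)) (layer : Fin n → ℕ) (second : Fin n → Bool)
  (layer≤ : ∀ u → layer u ≤ n)
  (layer-injective : ∀ {u v} → layer u ≡ layer v → second u ≡ second v → u ≡ v)
  (consecutive : ∀ {u v} → Adj G u v → layer v ≡ suc (layer u) ⊎ layer u ≡ suc (layer v)) where

  private
    key : Fin n → Key
    key u = parity (layer u) , ⌊ layer u /2⌋ , second u

    half≤ : ∀ u → ⌊ layer u /2⌋ ≤ n
    half≤ u = ≤-trans (⌊n/2⌋≤n (layer u)) (layer≤ u)

  ordering : Ordering (Fin n)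
  ordering = pullback <ₗ-isStrictTotalOrder key
    λ { {u} {v} (p , h , s) → layer-injective (parity-half-injective (layer u) (layer v) p h) s }

  ladder⇒contained : ∀ {N} (H : Graph (Fin N)) (P : Ordering (Fin N)) →
                     Ladder H P n → (G , ordering) ContainedIn (H , P)
  ladder⇒contained H P L = Embed.contained G ordering H P f f-mono f-adj
    where
    open Ladder L
    f : Fin n → _
    f u = at (parity (layer u)) ⌊ layer u /2⌋ (second u)

    at-mono : ∀ {b i s c j t} → i ≤ n → j ≤ n → (b , i , s) <ₗ (c , j , t) →
              Precedes P (at b i s) (at c j t)
    at-mono i≤ j≤ (inj₁ f<t)                        = sides _ _ i≤ j≤
    at-mono i≤ j≤ (inj₂ (refl , inj₁ i<j))          = mono _ _ _ i<j j≤
    at-mono i≤ j≤ (inj₂ (refl , inj₂ (refl , f<t))) = pairs _ j≤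

    f-mono : ∀ {u v} → key u <ₗ key v → Precedes P (f u) (f v)
    f-mono {u} {v} = at-mono (half≤ u) (half≤ v)

    at-adj : ∀ l {s t} → ⌊ suc l /2⌋ ≤ n →
             Adj H (at (parity l) ⌊ l /2⌋ s) (at (parity (suc l)) ⌊ suc l /2⌋ t)
    at-adj l h≤ with half-suc l
    ... | inj₁ (p , q , h) rewrite p | h = level _ _ h≤
    -- After rewriting, `h≤` is the strict bound on `⌊ l /2⌋` that `up` asks for.
    ... | inj₂ (p , q , h) rewrite p | h = Graph.symmetric H (up _ _ h≤)

    f-adj : ∀ {u v} → Adj G u v → Adj H (f u) (f v)
    f-adj {u} {v} uv with consecutive uv
    ... | inj₁ lv≡1+lu = subst (λ l → Adj H (f u) (at (parity l) ⌊ l /2⌋ (second v))) (sym lv≡1+lu)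
                           (at-adj (layer u) (subst (λ l → ⌊ l /2⌋ ≤ n) lv≡1+lu (half≤ v)))
    ... | inj₂ lu≡1+lv = subst (λ l → Adj H (at (parity l) ⌊ l /2⌋ (second u)) (f v)) (sym lu≡1+lv)
                           (Graph.symmetric H (at-adj (layer v) (subst (λ l → ⌊ l /2⌋ ≤ n) lu≡1+lv (half≤ u))))

-- Doubled paths in dense ordered graphs

combine-monoʳ-< : ∀ {m n} (i : Fin m) {j k : Fin n} → j Fin.< k → combine i j Fin.< combine i k
combine-monoʳ-< {n = n} i {j} {k} j<k =
  subst₂ _<_ (sym (toℕ-combine i j)) (sym (toℕ-combine i k)) (+-monoʳ-< (n * toℕ i) j<k)

cast-mono-< : ∀ {m n} .(m≡n : m ≡ n) {i j : Fin m} → i Fin.< j → cast m≡n i Fin.< cast m≡n j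
cast-mono-< m≡n {i} {j} = subst₂ _<_ (sym (toℕ-cast m≡n i)) (sym (toℕ-cast m≡n j))

-- A block of side `M₁ * B₁` has its columns regrouped as `M₂ * B₂`, a number equal to the side only
-- propositionally.
castColumns : ∀ {m n n′} → n′ ≡ n → Matrix m n → Matrix m n′
castColumns n′≡n A i j = A i (cast n′≡n j)

count-castColumns : ∀ {m n n′} (n′≡n : n′ ≡ n) (A : Matrix m n) → count (castColumns n′≡n A) ≡ count A
count-castColumns refl A =
  sum-cong-≗ (λ i → sum-cong-≗ (λ j → cong (λ c → 𝟙 (A i c)) (cast-is-id refl j)))

doubleColumns : ∀ {m n M B} → M * B ≡ n → Matrix m n → Fin B → Fin B → Matrix m M
doubleColumns MB≡n A q q′ = (doubleRows ((castColumns MB≡n A) ᵀ) q q′) ᵀ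

count-doubleColumns : ∀ {m n M B} (MB≡n : M * B ≡ n) (A : Matrix m n) t →
                      M * m + B * (B * t) < count A →
                      ∃₂ λ q q′ → t < count (doubleColumns {M = M} MB≡n A q q′)
count-doubleColumns {M = M} MB≡n A t h
  with q , q′ , h′ ← count-doubleRows {M} ((castColumns MB≡n A) ᵀ) t
         (<-≤-trans h (≤-reflexive (sym (trans (count-ᵀ (castColumns MB≡n A)) (count-castColumns MB≡n A)))))
  = q , q′ , <-≤-trans h′ (≤-reflexive (sym (count-ᵀ (doubleRows {M} ((castColumns MB≡n A) ᵀ) q q′))))

adjacency : ∀ {m N} → Graph (Fin N) → (Fin m → Fin N) → Matrix m m
adjacency H σ r c = ⌊ adj? H (σ r) (σ c) ⌋

-- The numbers of ones to be exceeded before each step, computed backwards: `M₂ * M₁` and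
-- `M₁ * (M₁ * B₁)` are the losses in doubling, and the squares of `B₂` and `B₁` count pairs of
-- offsets.
zigzagThreshold columnThreshold rowThreshold : (B₁ B₂ M₁ M₂ k : ℕ) → ℕ
zigzagThreshold B₁ B₂ M₁ M₂ k = k * (M₁ + M₂)
columnThreshold B₁ B₂ M₁ M₂ k = M₂ * M₁ + B₂ * (B₂ * zigzagThreshold B₁ B₂ M₁ M₂ k)
rowThreshold    B₁ B₂ M₁ M₂ k = M₁ * (M₁ * B₁) + B₁ * (B₁ * columnThreshold B₁ B₂ M₁ M₂ k)

module _ {N} (H : Graph (Fin N)) (P : Ordering (Fin N))
         {K B₁ B₂ M₁ M₂} (M₂B₂≡M₁B₁ : M₂ * B₂ ≡ M₁ * B₁)
         (σ : Fin (K * (M₁ * B₁)) → Fin N)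
         (σ-mono : ∀ {i j} → i Fin.< j → Precedes P (σ i) (σ j)) where

  fourfold : Fin K → Fin K → Fin B₁ → Fin B₁ → Fin B₂ → Fin B₂ → Matrix M₁ M₂
  fourfold i j p p′ q q′ =
    doubleColumns M₂B₂≡M₁B₁ (doubleRows (block (adjacency H σ) i j) p p′) q q′

  row : Fin K → Fin M₁ → Fin B₁ → Fin (K * (M₁ * B₁))
  row i r p = combine i (combine r p)

  column : Fin K → Fin M₂ → Fin B₂ → Fin (K * (M₁ * B₁))
  column j c q = combine j (cast M₂B₂≡M₁B₁ (combine c q))

  pick : {A : Set} → A → A → Bool → A
  pick a a′ s = if s then a′ else a

  -- Columns were doubled last, so their pair is unpacked first. The order of the offsets comes from
  -- `pair`, since the pigeonhole principle says nothing about it.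
  fourfold⇒ : ∀ {i j p p′ q q′} r c → T (fourfold i j p p′ q q′ r c) →
              p Fin.< p′ × q Fin.< q′ ×
              (∀ s t → Adj H (σ (row i r (pick p p′ s))) (σ (column j c (pick q q′ t))))
  fourfold⇒ {i} {j} {p} {p′} {q} {q′} r c h
    with q<q′ , hq , hq′ ← pair⇒ (λ q → castColumns M₂B₂≡M₁B₁ (doubleRows (block (adjacency H σ) i j) p p′) r (combine c q)) q q′ h
    with p<p′ , hpq , hp′q ← pair⇒ (λ p → adjacency H σ (row i r p) (column j c q)) p p′ hq
    with _ , hpq′ , hp′q′ ← pair⇒ (λ p → adjacency H σ (row i r p) (column j c q′)) p p′ hq′
    = p<p′ , q<q′ , λ
    { false false → toWitness hpq ; false true → toWitness hpq′
    ; true false → toWitness hp′q ; true true → toWitness hp′q′ }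

  -- Even layers go to rows in interval `i`, odd ones to columns in interval `j`. Groups are ordered
  -- by the zigzag, the two vertices of a group by the offsets.
  zigzag⇒Ladder : ∀ {k i j p p′ q q′ r c} → i Fin.< j →
                  Zigzag (fourfold i j p p′ q q′) k r c → Ladder H P k
  zigzag⇒Ladder {k} {i} {j} {p} {p′} {q} {q′} i<j Z
    -- Entry 0 of the zigzag exists even for `k = 0`.
    with p<p′ , q<q′ , _ ← fourfold⇒ (Zigzag.x Z 0) (Zigzag.y Z 0) (Zigzag.level Z z≤n)
    = record
    { at    = at
    ; sides = λ s t _ _ → σ-mono (combine-monoˡ-< {m = K} {n = M₁ * B₁} _ _ i<j)
    ; mono  = mono
    ; pairs = pairs
    ; level = λ s t j≤k → proj₂ (proj₂ (fourfold⇒ (x _) (y _) (level j≤k))) s t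
    ; up    = λ s t j<k → proj₂ (proj₂ (fourfold⇒ (x _) (y _) (up j<k))) s t
    }
    where
    open Zigzag Z
    at : Bool → ℕ → Bool → Fin N
    at false l s = σ (row i (x l) (pick p p′ s))
    at true  l s = σ (column j (y l) (pick q q′ s))

    mono : ∀ b {l l′} s t → l < l′ → l′ ≤ k → Precedes P (at b l s) (at b l′ t)
    mono false s t l<l′ l′≤k = σ-mono (combine-monoʳ-< {K} {M₁ * B₁} i (combine-monoˡ-< {m = M₁} {n = B₁} _ _ (x-mono l<l′ l′≤k)))
    mono true  s t l<l′ l′≤k =
      σ-mono (combine-monoʳ-< {K} {M₁ * B₁} j (cast-mono-< M₂B₂≡M₁B₁ (combine-monoˡ-< {m = M₂} {n = B₂} _ _ (y-mono l<l′ l′≤k))))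

    pairs : ∀ b {l} → l ≤ k → Precedes P (at b l false) (at b l true)
    pairs false _ = σ-mono (combine-monoʳ-< {K} {M₁ * B₁} i (combine-monoʳ-< {M₁} {B₁} _ p<p′))
    pairs true  _ = σ-mono (combine-monoʳ-< {K} {M₁ * B₁} j (cast-mono-< M₂B₂≡M₁B₁ (combine-monoʳ-< {M₂} {B₂} _ q<q′)))

  ladder-columns : ∀ k {i j p p′} → i Fin.< j →
                   columnThreshold B₁ B₂ M₁ M₂ k <
                   count (doubleRows {M₁} (block {K} (adjacency H σ) i j) p p′) →
                 Ladder H P k
  ladder-columns k {i} {j} {p} {p′} i<j h =
    let q , q′ , h′ = count-doubleColumns {M = M₂} {B = B₂} M₂B₂≡M₁B₁
                        (doubleRows {M₁} {B₁} (block {K} (adjacency H σ) i j) p p′)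
                        (zigzagThreshold B₁ B₂ M₁ M₂ k) h
        r , c , Z   = zigzag k (fourfold i j p p′ q q′) h′
    in zigzag⇒Ladder {k} {i} {j} {p} {p′} {q} {q′} i<j Z

  ladder-rows : ∀ k {i j} → i Fin.< j →
                rowThreshold B₁ B₂ M₁ M₂ k < count (block {K} (adjacency H σ) i j) → Ladder H P k
  ladder-rows k {i} {j} i<j h =
    let p , p′ , h′ = count-doubleRows {M₁} {B₁} (block {K} (adjacency H σ) i j)
                        (columnThreshold B₁ B₂ M₁ M₂ k) h
    in ladder-columns k {i} {j} {p} {p′} i<j h′

  ladder : ∀ k → K * ((M₁ * B₁) * (M₁ * B₁) + K * rowThreshold B₁ B₂ M₁ M₂ k) < count (adjacency H σ) → Ladder H P k
  ladder k h =
    let i , j , i<j , h′ = offDiagonalBlock {K} {M₁ * B₁} (adjacency H σ)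
           (λ r c rc → fromWitness (Graph.symmetric H (toWitness {a? = adj? H (σ r) (σ c)} rc))) (rowThreshold B₁ B₂ M₁ M₂ k) h
    in ladder-rows k {i} {j} i<j h′

-- Sorting the vertices and counting the edges

sum-lookup : ∀ {A : Set} (g : A → ℕ) (xs : List A) → sum (g ∘ lookup xs) ≡ List.sum (map g xs)
sum-lookup g []       = refl
sum-lookup g (x ∷ xs) = cong (g x +_) (sum-lookup g xs)

sum-tabulate : ∀ {A : Set} (g : A → ℕ) {n} (f : Fin n → A) → List.sum (map g (tabulate f)) ≡ sum (g ∘ f)
sum-tabulate g {zero}  f = refl
sum-tabulate g {suc n} f = cong (g (f zero) +_) (sum-tabulate g (f ∘ suc))

sum-cast : ∀ {m n} (eq : m ≡ n) (g : Fin n → ℕ) → sum (g ∘ cast eq) ≡ sum g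
sum-cast refl g = sum-cong-≗ (λ i → cong g (cast-is-id refl i))

lookup-AllPairs : ∀ {A : Set} {R : A → A → Set} {xs} → AllPairs R xs →
                  ∀ {i j} → i Fin.< j → R (lookup xs i) (lookup xs j)
lookup-AllPairs (Rx ∷ _)   {zero}  {suc j} _         = All.lookup Rx (∈-lookup j)
lookup-AllPairs (_  ∷ Rxs) {suc i} {suc j} (s≤s i<j) = lookup-AllPairs Rxs i<j

-- Along `σ`, intervals of indices become intervals of `P`. Invariance of sums expresses that `σ` is
-- a permutation, in the form in which ones are counted.
sorting : ∀ {N} (P : Ordering (Fin N)) →
          Σ[ σ ∈ (Fin N → Fin N) ] (∀ {i j} → i Fin.< j → Precedes P (σ i) (σ j)) ×
                                   (∀ g → sum (g ∘ σ) ≡ sum g)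
sorting {N} P = σ
  , (λ i<j → lookup-AllPairs ascending (cast-mono-< (sym length≡N) i<j))
  , λ g → begin
    sum (g ∘ σ)              ≡⟨ sum-cast (sym length≡N) (g ∘ lookup xs) ⟩
    sum (g ∘ lookup xs)      ≡⟨ sum-lookup g xs ⟩
    List.sum (map g xs)      ≡⟨ sum-↭ (map⁺ g xs↭) ⟩
    List.sum (map g (allFin N)) ≡⟨ sum-tabulate g id ⟩
    sum g                    ∎
  where
  open ≡-Reasoning
  S : StrictTotalOrder _ _ _
  S = record { isStrictTotalOrder = Ordering.isStrictTotalOrder P }
  O = StrictTotal.decTotalOrder S

  xs : List (Fin N)
  xs = sort O (allFin N)

  xs↭ : xs ↭ allFin N
  xs↭ = sort-↭ O (allFin N)

  length≡N : length xs ≡ N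
  length≡N = trans (↭-length xs↭) (length-tabulate id)

  unique : Unique xs
  unique = Permutation.Unique-resp-↭ (setoid _) (↭⇒↭ₛ (↭-sym xs↭)) (allFin⁺ N)

  ascending : AllPairs (Precedes P) xs
  -- Sorting gives a weakly increasing list; the absence of repetitions makes it strict.
  ascending = AllPairs.zipWith (λ { (inj₁ x≺y , _) → x≺y ; (inj₂ x≡y , x≢y) → contradiction x≡y x≢y })
                (Sorted⇒AllPairs (StrictTotal.totalOrder S) (sort-↗ O (allFin N)) , unique)

  σ : Fin N → Fin N
  σ = lookup xs ∘ cast (sym length≡N)

length-filter-map : ∀ {A B : Set} {P : B → Set} (P? : Decidable P) (f : A → B) (g : A → ℕ) →
                    (∀ x → P (f x) → 1 ≤ g x) → ∀ xs →
                    length (filter P? (map f xs)) ≤ List.sum (map g xs)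
length-filter-map P? f g P⇒1≤g []       = z≤n
length-filter-map P? f g P⇒1≤g (x ∷ xs) with P? (f x)
... | yes Pfx = +-mono-≤ (P⇒1≤g x Pfx) (length-filter-map P? f g P⇒1≤g xs)
... | no  _   = ≤-trans (length-filter-map P? f g P⇒1≤g xs) (m≤n+m _ (g x))

length-filter-cartesianProduct :
  ∀ {A B : Set} {P : A × B → Set} (P? : Decidable P) (g : A → B → ℕ) →
  (∀ x y → P (x , y) → 1 ≤ g x y) → ∀ xs ys →
  length (filter P? (cartesianProduct xs ys)) ≤ List.sum (map (λ x → List.sum (map (g x) ys)) xs)
length-filter-cartesianProduct P? g P⇒1≤g []       ys = z≤n
length-filter-cartesianProduct P? g P⇒1≤g (x ∷ xs) ys
  = begin
  length (filter P? (map (x ,_) ys ++ cartesianProduct xs ys))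
    ≡⟨ cong length (filter-++ P? (map (x ,_) ys) (cartesianProduct xs ys)) ⟩
  length (filter P? (map (x ,_) ys) ++ filter P? (cartesianProduct xs ys))
    ≡⟨ length-++ (filter P? (map (x ,_) ys)) ⟩
  length (filter P? (map (x ,_) ys)) + length (filter P? (cartesianProduct xs ys))
    ≤⟨ +-mono-≤ (length-filter-map P? (x ,_) (g x) (P⇒1≤g x) ys)
                (length-filter-cartesianProduct P? g P⇒1≤g xs ys) ⟩
  List.sum (map (g x) ys) + List.sum (map (λ x → List.sum (map (g x) ys)) xs)
    ∎
  where open ≤-Reasoning

1≤𝟙 : ∀ {A : Set} (A? : Dec A) → A → 1 ≤ 𝟙 ⌊ A? ⌋
1≤𝟙 (yes _) _ = ≤-refl
1≤𝟙 (no ¬a) a = contradiction a ¬a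

-- The matrix counts both orientations of an edge; this factor of two is given away.
edgeCount≤count : ∀ {N} (H : Graph (Fin N)) →
                  edgeCount H ≤ count (adjacency H id)
edgeCount≤count {N} H = begin
  edgeCount H
    ≤⟨ length-filter-cartesianProduct _ (λ u v → 𝟙 ⌊ adj? H u v ⌋) (λ u v (_ , uv) → 1≤𝟙 (adj? H u v) uv) (allFin N) (allFin N) ⟩
  List.sum (map (λ u → List.sum (map (λ v → 𝟙 ⌊ adj? H u v ⌋) (allFin N))) (allFin N))
    ≡⟨ sum-tabulate (λ u → List.sum (map (λ v → 𝟙 ⌊ adj? H u v ⌋) (allFin N))) id ⟩
  sum (λ u → List.sum (map (λ v → 𝟙 ⌊ adj? H u v ⌋) (allFin N)))
    ≡⟨ sum-cong-≗ (λ u → sum-tabulate (λ v → 𝟙 ⌊ adj? H u v ⌋) id) ⟩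
  count (adjacency H id)
    ∎
  where open ≤-Reasoning

count-adjacency : ∀ {N} (H : Graph (Fin N)) (σ : Fin N → Fin N) →
                  (∀ g → sum (g ∘ σ) ≡ sum g) →
                  count (adjacency H σ) ≡ count (adjacency H id)
count-adjacency H σ σ-sum =
  trans (sum-cong-≗ (λ i → σ-sum (λ v → 𝟙 ⌊ adj? H (σ i) v ⌋)))
        (σ-sum (λ u → sum (λ v → 𝟙 ⌊ adj? H u v ⌋)))

-- From rational density to natural numbers

toℚᵘ-fromℕ : ∀ k → toℚᵘ (fromℕ k) ≃ mkℚᵘ (ℤ.+ k) 0
toℚᵘ-fromℕ k = ℚ.toℚᵘ-fromℚᵘ (mkℚᵘ (ℤ.+ k) 0)

toℚᵘ-*fromℕ-≤ : ∀ q k l → q ℚ.* fromℕ k ℚ.≤ fromℕ l →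
                toℚᵘ q ℚᵘ.* mkℚᵘ (ℤ.+ k) 0 ℚᵘ.≤ mkℚᵘ (ℤ.+ l) 0
toℚᵘ-*fromℕ-≤ q k l h = begin
  toℚᵘ q ℚᵘ.* mkℚᵘ (ℤ.+ k) 0       ≃⟨ ℚᵘ.*-congˡ {toℚᵘ q} (toℚᵘ-fromℕ k) ⟨
  toℚᵘ q ℚᵘ.* toℚᵘ (fromℕ k)     ≃⟨ ℚ.toℚᵘ-homo-* q (fromℕ k) ⟨
  toℚᵘ (q ℚ.* fromℕ k)           ≤⟨ ℚ.toℚᵘ-mono-≤ h ⟩
  toℚᵘ (fromℕ l)                 ≃⟨ toℚᵘ-fromℕ l ⟩
  mkℚᵘ (ℤ.+ l) 0                   ∎
  where open ℚᵘ.≤-Reasoning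

-- A positive rational has numerator at least 1, so it is at least the reciprocal of its
-- denominator.
*fromℕ-≤⇒≤ : ∀ q → 0ℚ ℚ.< q → ∀ k l → q ℚ.* fromℕ k ℚ.≤ fromℕ l → k ≤ ℚ.denominatorℕ q * l
*fromℕ-≤⇒≤ q@(mkℚ (ℤ.+ suc a) d-1 c) 0<q k l h = begin
  k                   ≤⟨ m≤n*m k (suc a) ⟩
  suc a * k           ≡⟨ *-identityʳ (suc a * k) ⟨
  suc a * k * 1       ≤⟨ ℤ.drop‿+≤+ (subst₂ ℤ._≤_ lhs rhs (ℚᵘ.drop-*≤* (toℚᵘ-*fromℕ-≤ q k l h))) ⟩
  l * (suc d-1 * 1)   ≡⟨ cong (l *_) (*-identityʳ (suc d-1)) ⟩
  l * suc d-1         ≡⟨ *-comm l (suc d-1) ⟩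
  suc d-1 * l         ∎
  where
  open ≤-Reasoning
  lhs : ℤ.+ suc a ℤ.* ℤ.+ k ℤ.* ℤ.+ 1 ≡ ℤ.+ (suc a * k * 1)
  lhs = trans (cong (ℤ._* ℤ.+ 1) (sym (ℤ.pos-* (suc a) k))) (sym (ℤ.pos-* (suc a * k) 1))
  rhs : ℤ.+ l ℤ.* ℤ.+ (suc d-1 * 1) ≡ ℤ.+ (l * (suc d-1 * 1))
  rhs = sym (ℤ.pos-* l (suc d-1 * 1))
*fromℕ-≤⇒≤ (mkℚ (ℤ.+ zero) d-1 _) (ℚ.*<* (ℤ.+<+ ()))
*fromℕ-≤⇒≤ (mkℚ ℤ.-[1+ a ] d-1 _) (ℚ.*<* ())

-- The choice of constants

rowThreshold-expand : ∀ s q n →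
  let m = s * s * q * s in
  m * m + s * rowThreshold s (s * s) (s * s * q) (s * q) n
    ≡ 3 * (m * m) + s * s * s * (s * s * s) * q * ((s * s * s + s * s) * n)
-- The thresholds are written out to give the ring solver a polynomial identity.
rowThreshold-expand = unfolded
  where
  unfolded : ∀ s q n →
    let m = s * s * q * s in
    m * m + s * (s * s * q * m + s * (s * (s * q * (s * s * q) +
      s * s * (s * s * (n * (s * s * q + s * q))))))
      ≡ 3 * (m * m) + s * s * s * (s * s * s) * q * ((s * s * s + s * s) * n)
  unfolded = solve-∀

m*m-expand : ∀ s q →
  let m = s * s * q * s in
  3 * (m * m) + s * s * s * (s * s * s) * q * q ≡ 4 * (m * m)
m*m-expand = solve-∀

-- The unit `q` of all sizes: an interval has `s³ q` vertices and `N = s⁴ q`, so `N` is linear in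
-- `n`.
ladderWidth : ℕ → ℕ → ℕ
ladderWidth s n = (s * s * s + s * s + 1) * n

ladderWidth-expand : ∀ s n → (s * s * s + s * s + 1) * n ≡ (s * s * s + s * s) * n + n
ladderWidth-expand = solve-∀

-- The losses m m, s M₁ m and s³ M₂ M₁ of the first three steps all equal m m. What
-- remains of 4 m m pays for the zigzag, because q > (s³ + s²) n.
threshold< : ∀ d n e .{{_ : NonZero d}} .{{_ : NonZero n}} →
             let s = 4 * d ; q = ladderWidth s n ; m = s * s * q * s in
             (s * m) * (s * m) ≤ d * e →
             s * (m * m + s * rowThreshold s (s * s) (s * s * q) (s * q) n) < e
threshold< d n e N²≤de = *-cancelˡ-< s _ _ (begin-strict
  s * (s * (m * m + s * rowThreshold s (s * s) (s * s * q) (s * q) n))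
    ≡⟨ cong (λ x → s * (s * x)) (rowThreshold-expand s q n) ⟩
  s * (s * (3 * (m * m) + s⁶q * ((s * s * s + s * s) * n)))
    <⟨ *-monoʳ-< s (*-monoʳ-< s (+-monoʳ-< (3 * (m * m)) (*-monoʳ-< s⁶q <q))) ⟩
  s * (s * (3 * (m * m) + s⁶q * q))
    ≡⟨ cong (λ x → s * (s * x)) (m*m-expand s q) ⟩
  s * (s * (4 * (m * m)))
    ≡⟨ square s m ⟩
  -- Here `s * m` is `N`, and `s = 4 * d` is chosen to turn `4 * (d * e)` into `s * e`, whose factor
  -- `s` cancels.
  4 * ((s * m) * (s * m))
    ≤⟨ *-monoʳ-≤ 4 N²≤de ⟩
  4 * (d * e)
    ≡⟨ *-assoc 4 d e ⟨
  s * e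
    ∎)
  where
  open ≤-Reasoning
  s q m s⁶q : ℕ
  s   = 4 * d
  q   = ladderWidth s n
  m   = s * s * q * s
  s⁶q = s * s * s * (s * s * s) * q

  square : ∀ s m → s * (s * (4 * (m * m))) ≡ 4 * ((s * m) * (s * m))
  square = solve-∀

  <q : (s * s * s + s * s) * n < q
  <q = subst ((s * s * s + s * s) * n <_) (sym (ladderWidth-expand s n)) (m<m+n _ (ℕ.>-nonZero⁻¹ n))

  instance
    s≢0 : NonZero s
    s≢0 = m*n≢0 4 d
    q≢0 : NonZero q
    q≢0 = >-nonZero (≤-<-trans z≤n <q)
    s³≢0 : NonZero (s * s * s)
    s³≢0 = m*n≢0 (s * s) s {{m*n≢0 s s}}
    s⁶q≢0 : NonZero s⁶q
    s⁶q≢0 = m*n≢0 (s * s * s * (s * s * s)) q {{m*n≢0 (s * s * s) (s * s * s)}}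

-- Rows are grouped by `s`. Doubling them lowers the guaranteed density from order `1/s` to order
-- `1/s²`, so columns are grouped by `s * s`. With the equation for `N` as a hypothesis, matching on
-- `refl` replaces a cast of the vertices.
dense⇒Ladder : ∀ d n .{{_ : NonZero d}} .{{_ : NonZero n}} {N} →
               let s = 4 * d in N ≡ s * (s * s * ladderWidth s n * s) →
               (H : Graph (Fin N)) (P : Ordering (Fin N)) →
               N * N ≤ d * edgeCount H → Ladder H P n
dense⇒Ladder d n refl H P N²≤de =
  let σ , σ-mono , σ-sum = sorting P
  in ladder H P {s} {s} {s * s} {s * s * q} {s * q} (M₂B₂≡M₁B₁ s q) σ σ-mono n
       (threshold< d n (count (adjacency H σ)) (≤-trans N²≤de (*-monoʳ-≤ d
         (≤-trans (edgeCount≤count H) (≤-reflexive (sym (count-adjacency H σ σ-sum)))))))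
  where
  s q : ℕ
  s = 4 * d
  q = ladderWidth s n

  M₂B₂≡M₁B₁ : ∀ s q → s * q * (s * s) ≡ s * s * q * s
  M₂B₂≡M₁B₁ = solve-∀

ladderFactor : ℕ → ℕ
ladderFactor d = let s = 4 * d in s * (s * s * (s * s * s + s * s + 1) * s)

ladderFactor-* : ∀ d n → let s = 4 * d in ladderFactor d * n ≡ s * (s * s * ladderWidth s n * s)
ladderFactor-* d n = reassociate (4 * d) n
  where
  reassociate : ∀ s n → s * (s * s * (s * s * s + s * s + 1) * s) * n
                      ≡ s * (s * s * ((s * s * s + s * s + 1) * n) * s)
  reassociate = solve-∀

theorem3p3 : (ε : ℝ) → Positive ε →
    Σ[ C ∈ ℕ ]
    ((n : ℕ) → 0 < n →
    (G : Graph (Fin n)) → Bipartite G → maxDegree G ≤ 2 →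
    Σ[ ≺ ∈ Ordering (Fin n) ]
    ((H : Graph (Fin (C * n))) (≺H : Ordering (Fin (C * n))) →
    ε * ((C * n) * (C * n)) ≤ℝ edgeCount H →
    (G , ≺) ContainedIn (H , ≺H)))
-- The density hypothesis is used only at one rational `r` strictly between 0 and `ε`; the constant
-- depends on `ε` through the denominator of `r`.
theorem3p3 ε ε>0 with r , 0<r , r<ε ← ℝ.lower-open ε ε>0 = ladderFactor d , contained-in-dense
  where
  d : ℕ
  d = ℚ.denominatorℕ r

  contained-in-dense : (n : ℕ) → 0 < n →
    (G : Graph (Fin n)) → Bipartite G → maxDegree G ≤ 2 →
    Σ[ ≺ ∈ Ordering (Fin n) ]
    ((H : Graph (Fin (ladderFactor d * n))) (≺H : Ordering (Fin (ladderFactor d * n))) →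
    ε * ((ladderFactor d * n) * (ladderFactor d * n)) ≤ℝ edgeCount H →
    (G , ≺) ContainedIn (H , ≺H))
  contained-in-dense n 0<n G (side , side-≢) Δ≤2 =
    ordering , λ H ≺H dense → ladder⇒contained H ≺H
      (dense⇒Ladder d n {{_}} {{>-nonZero 0<n}} (ladderFactor-* d n) H ≺H
        (*fromℕ-≤⇒≤ r 0<r (N * N) (edgeCount H) (dense r r<ε)))
    where
    N : ℕ
    N = ladderFactor d * n

    open Layers G side side-≢ (neighbours G Δ≤2)
    open Layering (layering-⊤ 0<n)
    open LadderOrder G layer second
      (λ u → subst (layer u ≤_) (∣⊤∣≡n n) (<⇒≤ (layer< ∈⊤)))
      (injective ∈⊤ ∈⊤) (consecutive ∈⊤ ∈⊤)
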